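{- The logic $\mathrm{ILM}$ is an extension of the logic $\mathrm{JP'}$; that is, every formula of $\mathrm{JP'}$ is a formula of $\mathrm{ILM}$, and for every formula $\alpha$ of $\mathrm{JP'}$, $\vdash_{\mathrm{JP'}}\alpha$ if and only if $\vdash_{\mathrm{ILM}}\alpha$.
   Context: A logic $\mathrm{L'}$ with set of formulas $F'$ is called an extension of a logic $\mathrm{L}$ with set of formulas $F$ if $F\subseteq F'$ and for all $\alpha\in F$: $\vdash_{\mathrm{L}}\alpha$ iff $\vdash_{\mathrm{L'}}\alpha$. Formulas of $\mathrm{ILM}$ are built from propositional variables and constants $\top,\bot$ with $\wedge,\vee,\rightarrow,\neg,\sim$; $\alpha\leftrightarrow\beta$ abbreviates $(\alpha\rightarrow\beta)\wedge(\beta\rightarrow\alpha)$. Its axiom schemes are: (A1) $\alpha\rightarrow(\beta\rightarrow\alpha)$; (A2) $(\alpha\rightarrow(\beta\rightarrow\gamma))\rightarrow((\alpha\rightarrow\beta)\rightarrow(\alpha\rightarrow\gamma))$; (A3) $\alpha\rightarrow(\alpha\vee\beta)$, $\beta\rightarrow(\alpha\vee\beta)$; (A4) $(\alpha\rightarrow\gamma)\rightarrow((\beta\rightarrow\gamma)\rightarrow((\alpha\vee\beta)\rightarrow\gamma))$; (A5) $(\alpha\wedge\beta)\rightarrow\alpha$, $(\alpha\wedge\beta)\rightarrow\beta$; (A6) $(\alpha\rightarrow\beta)\rightarrow((\alpha\rightarrow\gamma)\rightarrow(\alpha\rightarrow(\beta\wedge\gamma)))$; (A7) $\alpha\rightarrow\top$;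 (A8) $\bot\rightarrow\alpha$; (A9) $(\alpha\rightarrow\beta)\rightarrow((\alpha\rightarrow\neg\beta)\rightarrow\neg\alpha)$; (A10) $\neg\alpha\rightarrow(\alpha\rightarrow\beta)$; (A11) $\sim\alpha\leftrightarrow(\alpha\rightarrow\neg\neg\sim\top)$. Modus ponens is the only rule. Formulas of $\mathrm{JP'}$ are built from propositional variables and the constant $\top$ with $\vee,\wedge,\rightarrow,\sim$. Its axiom schemes are (A1)–(A7), (A13) $(\alpha\rightarrow\beta)\rightarrow((\alpha\rightarrow\sim\beta)\rightarrow\sim\alpha)$, and (P$'$) $\sim\sim(\sim\top\rightarrow\beta)$. Modus ponens is the only rule. -}

module Defs where

open import Data.Nat using (ℕ)
open import Data.Product using (_×_)
open import Function.Bundles using (_⇔_)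
open import Level using (0ℓ) renaming (suc to lsuc)
open import Relation.Unary using (Pred; _∈_; _⊆_; _∪_)

infix  9 ¬_ ∼_
infixr 8 _∧_
infixr 7 _∨_
infixr 6 _⇒_
infix  5 _↔_

-- Expressions over the union of the two languages.  The formulas of a given
-- logic are singled out by a predicate, so that the inclusion of one set of
-- formulas in another can be stated literally.
data Expr : Set where
  var         : ℕ → Expr
  ⊤ ⊥         : Expr
  _∧_ _∨_ _⇒_ : Expr → Expr → Expr
  ¬_ ∼_       : Expr → Expr

_↔_ : Expr → Expr → Expr
α ↔ β = (α ⇒ β) ∧ (β ⇒ α)

data FormulaILM : Pred Expr 0ℓ where
  var : ∀ n → FormulaILM (var n)
  ⊤   : FormulaILM ⊤
  ⊥   : FormulaILM ⊥
  _∧_ : ∀ {α β} → FormulaILM α → FormulaILM β → FormulaILM (α ∧ β)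
  _∨_ : ∀ {α β} → FormulaILM α → FormulaILM β → FormulaILM (α ∨ β)
  _⇒_ : ∀ {α β} → FormulaILM α → FormulaILM β → FormulaILM (α ⇒ β)
  ¬_  : ∀ {α} → FormulaILM α → FormulaILM (¬ α)
  ∼_  : ∀ {α} → FormulaILM α → FormulaILM (∼ α)

data FormulaJP′ : Pred Expr 0ℓ where
  var : ∀ n → FormulaJP′ (var n)
  ⊤   : FormulaJP′ ⊤
  _∧_ : ∀ {α β} → FormulaJP′ α → FormulaJP′ β → FormulaJP′ (α ∧ β)
  _∨_ : ∀ {α β} → FormulaJP′ α → FormulaJP′ β → FormulaJP′ (α ∨ β)
  _⇒_ : ∀ {α β} → FormulaJP′ α → FormulaJP′ β → FormulaJP′ (α ⇒ β)
  ∼_  : ∀ {α} → FormulaJP′ α → FormulaJP′ (∼ α)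

-- A logic given by axiom schemes, with modus ponens as its only rule.
record Logic : Set (lsuc 0ℓ) where
  field
    Formula : Pred Expr 0ℓ
    Scheme  : Pred Expr 0ℓ

open Logic public

infix 4 _⊢_

-- `Scheme L` is closed under instantiation by arbitrary expressions; the
-- premise `α ∈ Formula L` cuts it down to instances in the language of L.
-- (Every metavariable of a scheme occurs in its instances, so this is the same
-- as instantiating the metavariables by formulas of L.)  Modus ponens needs no
-- such premise: all theorems are formulas, as β is a subformula of α ⇒ β.
data _⊢_ (L : Logic) : Pred Expr 0ℓ where
  axiom : ∀ {α} → α ∈ Formula L → α ∈ Scheme L → L ⊢ α
  mp    : ∀ {α β} → L ⊢ α ⇒ β → L ⊢ α → L ⊢ β

data SchemeA1–A7 : Pred Expr 0ℓ where
  A1  : ∀ α β   → SchemeA1–A7 (α ⇒ (β ⇒ α))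
  A2  : ∀ α β γ → SchemeA1–A7 ((α ⇒ (β ⇒ γ)) ⇒ ((α ⇒ β) ⇒ (α ⇒ γ)))
  A3ˡ : ∀ α β   → SchemeA1–A7 (α ⇒ (α ∨ β))
  A3ʳ : ∀ α β   → SchemeA1–A7 (β ⇒ (α ∨ β))
  A4  : ∀ α β γ → SchemeA1–A7 ((α ⇒ γ) ⇒ ((β ⇒ γ) ⇒ ((α ∨ β) ⇒ γ)))
  A5ˡ : ∀ α β   → SchemeA1–A7 ((α ∧ β) ⇒ α)
  A5ʳ : ∀ α β   → SchemeA1–A7 ((α ∧ β) ⇒ β)
  A6  : ∀ α β γ → SchemeA1–A7 ((α ⇒ β) ⇒ ((α ⇒ γ) ⇒ (α ⇒ (β ∧ γ))))
  A7  : ∀ α     → SchemeA1–A7 (α ⇒ ⊤)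

data SchemeA8–A11 : Pred Expr 0ℓ where
  A8  : ∀ α   → SchemeA8–A11 (⊥ ⇒ α)
  A9  : ∀ α β → SchemeA8–A11 ((α ⇒ β) ⇒ ((α ⇒ ¬ β) ⇒ ¬ α))
  A10 : ∀ α β → SchemeA8–A11 (¬ α ⇒ (α ⇒ β))
  A11 : ∀ α   → SchemeA8–A11 (∼ α ↔ (α ⇒ ¬ ¬ ∼ ⊤))

data SchemeA13,P′ : Pred Expr 0ℓ where
  A13 : ∀ α β → SchemeA13,P′ ((α ⇒ β) ⇒ ((α ⇒ ∼ β) ⇒ ∼ α))
  P′  : ∀ β   → SchemeA13,P′ (∼ ∼ (∼ ⊤ ⇒ β))

ILM : Logic
ILM = record
  { Formula = FormulaILM
  ; Scheme  = SchemeA1–A7 ∪ SchemeA8–A11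
  }

JP′ : Logic
JP′ = record
  { Formula = FormulaJP′
  ; Scheme  = SchemeA1–A7 ∪ SchemeA13,P′
  }

infix 4 _IsExtensionOf_

_IsExtensionOf_ : Logic → Logic → Set
L′ IsExtensionOf L =
  (Formula L ⊆ Formula L′) × (∀ {α} → α ∈ Formula L → (L ⊢ α ⇔ L′ ⊢ α))

{-# OPTIONS --safe #-}

-- In JP′ the formula ∼ α is interderivable with α ⇒ f, where f = ∼ ⊤, and P′
-- says ((f ⇒ β) ⇒ f) ⇒ f.  Given a JP′-formula α whose variables are among
-- p₀ … pₙ₋₁, the formula b = pₙ₋₁ ∧ … ∧ p₀ ∧ f implies every JP′-formula in
-- these variables, so it can play the role of ⊥.  Reading ¬ φ as φ ⇒ b and
-- every other variable as ⊤ turns an ILM-derivation of α into a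
-- JP′-derivation of α: the crucial axiom A11 becomes f ↔ ((f ⇒ b) ⇒ b), whose
-- backward half follows from b ⇒ f and P′.

module Submission where

open import Defs

open import Data.List using (List; []; _∷_)
open import Data.List.Membership.Propositional using () renaming (_∈_ to _∈ᴸ_)
open import Data.List.Relation.Unary.Any using (here; there)
open import Data.Nat using (ℕ; zero; suc; _<_; _⊔_)
open import Data.Nat.Properties
  using (_<?_; n<1+n; m<1+n⇒m<n∨m≡n; m<n⇒m<n⊔o; m<n⇒m<o⊔n)
open import Data.Product using (_,_)
open import Data.Sum using (inj₁; inj₂)
open import Function using (id; _∘_)
open import Function.Bundles using (mk⇔)
open import Relation.Binary.PropositionalEquality
  using (_≡_; refl; cong; cong₂; subst)
open import Relation.Nullary using (yes; no; contradiction)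
open import Relation.Unary using (_∈_; _⊆_; _∪_; U)

-- Natural deduction over the positive axioms

module NaturalDeduction
  (L : Logic) (total : ∀ α → α ∈ Formula L) (positive : SchemeA1–A7 ⊆ Scheme L)
  where

  infix 4 _⊩_

  -- Theorems enter as leaves, so the deduction theorem `deduce` needs one uniform case for all
  -- axioms and applies to every logic containing A1-A7.
  data _⊩_ (Γ : List Expr) : Expr → Set where
    hyp : ∀ {α} → α ∈ᴸ Γ → Γ ⊩ α
    thm : ∀ {α} → L ⊢ α → Γ ⊩ α
    app : ∀ {α β} → Γ ⊩ α ⇒ β → Γ ⊩ α → Γ ⊩ β

  pattern #0 = hyp (here refl)
  pattern #1 = hyp (there (here refl))
  pattern #2 = hyp (there (there (here refl)))

  scheme : ∀ {Γ α} → α ∈ Scheme L → Γ ⊩ α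
  scheme {α = α} s = thm (axiom (total α) s)

  pos : ∀ {Γ α} → α ∈ SchemeA1–A7 → Γ ⊩ α
  pos s = scheme (positive s)

  const : ∀ {Γ α β} → Γ ⊩ β → Γ ⊩ α ⇒ β
  const = app (pos (A1 _ _))

  identity : ∀ {Γ α} → Γ ⊩ α ⇒ α
  identity {α = α} =
    app (app (pos (A2 α (α ⇒ α) α)) (pos (A1 _ _))) (pos (A1 _ _))

  deduce : ∀ {Γ α β} → α ∷ Γ ⊩ β → Γ ⊩ α ⇒ β
  deduce (hyp (here refl)) = identity
  deduce (hyp (there i))   = const (hyp i)
  deduce (thm t)           = const (thm t)
  deduce (app d e)         = app (app (pos (A2 _ _ _)) (deduce d)) (deduce e)

  discharge : ∀ {α} → [] ⊩ α → L ⊢ α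
  discharge (thm t)   = t
  discharge (app d e) = mp (discharge d) (discharge e)

  ∧-intro : ∀ {Γ α β} → Γ ⊩ α → Γ ⊩ β → Γ ⊩ α ∧ β
  ∧-intro {α = α} d e =
    app (app (app (pos (A6 α _ _)) identity) (const e)) d

  ∧-elimˡ : ∀ {Γ α β} → Γ ⊩ α ∧ β → Γ ⊩ α
  ∧-elimˡ = app (pos (A5ˡ _ _))

  ∧-elimʳ : ∀ {Γ α β} → Γ ⊩ α ∧ β → Γ ⊩ β
  ∧-elimʳ = app (pos (A5ʳ _ _))

-- From JP′ to ILM

FormulaILM-total : ∀ α → α ∈ FormulaILM
FormulaILM-total (var n) = var n
FormulaILM-total ⊤       = ⊤
FormulaILM-total ⊥       = ⊥
FormulaILM-total (α ∧ β) = FormulaILM-total α ∧ FormulaILM-total β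
FormulaILM-total (α ∨ β) = FormulaILM-total α ∨ FormulaILM-total β
FormulaILM-total (α ⇒ β) = FormulaILM-total α ⇒ FormulaILM-total β
FormulaILM-total (¬ α)   = ¬ FormulaILM-total α
FormulaILM-total (∼ α)   = ∼ FormulaILM-total α

module ILM-Derivations where
  open NaturalDeduction ILM FormulaILM-total inj₁

  ∼-intro : ∀ {Γ α} → α ∷ Γ ⊩ ¬ ¬ ∼ ⊤ → Γ ⊩ ∼ α
  ∼-intro d = app (∧-elimʳ (scheme (inj₂ (A11 _)))) (deduce d)

  ∼-elim : ∀ {Γ α} → Γ ⊩ ∼ α → Γ ⊩ α → Γ ⊩ ¬ ¬ ∼ ⊤
  ∼-elim d = app (app (∧-elimˡ (scheme (inj₂ (A11 _)))) d)

  ¬-intro : ∀ {Γ α} → α ∷ Γ ⊩ ¬ α → Γ ⊩ ¬ α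
  ¬-intro d = app (app (scheme (inj₂ (A9 _ _))) identity) (deduce d)

  ⊢A13,P′ : ∀ {α} → α ∈ SchemeA13,P′ → ILM ⊢ α
  ⊢A13,P′ (A13 α β) =
    discharge (deduce (deduce (∼-intro (∼-elim (app #1 #0) (app #2 #0)))))
  ⊢A13,P′ (P′ β) =
    -- From `¬ ∼ ⊤`, A10 gives `∼ ⊤ ⇒ β`, which against the hypothesis `∼ (∼ ⊤ ⇒ β)` yields
    -- `¬ ¬ ∼ ⊤`. So `¬ ∼ ⊤` implies its own negation.
    discharge (∼-intro (¬-intro (∼-elim #1 (app (scheme (inj₂ (A10 _ _))) #0))))

JP′⊆ILM : ∀ {α} → JP′ ⊢ α → ILM ⊢ α
JP′⊆ILM (axiom _ (inj₁ s)) = axiom (FormulaILM-total _) (inj₁ s)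
JP′⊆ILM (axiom _ (inj₂ s)) = ILM-Derivations.⊢A13,P′ s
JP′⊆ILM (mp d e)           = mp (JP′⊆ILM d) (JP′⊆ILM e)

-- Translations of expressions

width : Expr → ℕ
-- The successor makes `width` a strict bound on the variable indices.
width (var n) = suc n
width ⊤       = 0
width ⊥       = 0
width (α ∧ β) = width α ⊔ width β
width (α ∨ β) = width α ⊔ width β
width (α ⇒ β) = width α ⊔ width β
width (¬ α)   = width α
width (∼ α)   = width α

module Interpretation (σ : ℕ → Expr) (⊥* : Expr) (¬* : Expr → Expr) where

  ⟦_⟧ : Expr → Expr
  ⟦ var n ⟧ = σ n
  ⟦ ⊤ ⟧     = ⊤
  ⟦ ⊥ ⟧     = ⊥*
  ⟦ α ∧ β ⟧ = ⟦ α ⟧ ∧ ⟦ β ⟧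
  ⟦ α ∨ β ⟧ = ⟦ α ⟧ ∨ ⟦ β ⟧
  ⟦ α ⇒ β ⟧ = ⟦ α ⟧ ⇒ ⟦ β ⟧
  ⟦ ¬ α ⟧   = ¬* ⟦ α ⟧
  ⟦ ∼ α ⟧   = ∼ ⟦ α ⟧

  ⟦⟧-A1–A7 : ∀ {α} → α ∈ SchemeA1–A7 → ⟦ α ⟧ ∈ SchemeA1–A7
  ⟦⟧-A1–A7 (A1 _ _)   = A1 _ _
  ⟦⟧-A1–A7 (A2 _ _ _) = A2 _ _ _
  ⟦⟧-A1–A7 (A3ˡ _ _)  = A3ˡ _ _
  ⟦⟧-A1–A7 (A3ʳ _ _)  = A3ʳ _ _
  ⟦⟧-A1–A7 (A4 _ _ _) = A4 _ _ _
  ⟦⟧-A1–A7 (A5ˡ _ _)  = A5ˡ _ _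
  ⟦⟧-A1–A7 (A5ʳ _ _)  = A5ʳ _ _
  ⟦⟧-A1–A7 (A6 _ _ _) = A6 _ _ _
  ⟦⟧-A1–A7 (A7 _)     = A7 _

  ⟦⟧-A13,P′ : ∀ {α} → α ∈ SchemeA13,P′ → ⟦ α ⟧ ∈ SchemeA13,P′
  ⟦⟧-A13,P′ (A13 _ _) = A13 _ _
  ⟦⟧-A13,P′ (P′ _)    = P′ _

  ⟦⟧-fixed : ∀ {α} → α ∈ FormulaJP′ → (∀ {m} → m < width α → σ m ≡ var m) →
             ⟦ α ⟧ ≡ α
  ⟦⟧-fixed (var n) σ-fixed = σ-fixed (n<1+n n)
  ⟦⟧-fixed ⊤       σ-fixed = refl
  ⟦⟧-fixed (a ∧ b) σ-fixed = cong₂ _∧_ (⟦⟧-fixed a (σ-fixed ∘ m<n⇒m<n⊔o _))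
                                       (⟦⟧-fixed b (σ-fixed ∘ m<n⇒m<o⊔n _))
  ⟦⟧-fixed (a ∨ b) σ-fixed = cong₂ _∨_ (⟦⟧-fixed a (σ-fixed ∘ m<n⇒m<n⊔o _))
                                       (⟦⟧-fixed b (σ-fixed ∘ m<n⇒m<o⊔n _))
  ⟦⟧-fixed (a ⇒ b) σ-fixed = cong₂ _⇒_ (⟦⟧-fixed a (σ-fixed ∘ m<n⇒m<n⊔o _))
                                       (⟦⟧-fixed b (σ-fixed ∘ m<n⇒m<o⊔n _))
  ⟦⟧-fixed (∼ a)   σ-fixed = cong ∼_ (⟦⟧-fixed a σ-fixed)

-- JP′ over the full language, where derivations need no formula premises.
JP′⁺ : Logic
JP′⁺ = record
  { Formula = U
  ; Scheme  = SchemeA1–A7 ∪ SchemeA13,P′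
  }

module Erasure where
  open Interpretation var ⊤ id

  ⟦⟧-formula : ∀ α → ⟦ α ⟧ ∈ FormulaJP′
  ⟦⟧-formula (var n) = var n
  ⟦⟧-formula ⊤       = ⊤
  ⟦⟧-formula ⊥       = ⊤
  ⟦⟧-formula (α ∧ β) = ⟦⟧-formula α ∧ ⟦⟧-formula β
  ⟦⟧-formula (α ∨ β) = ⟦⟧-formula α ∨ ⟦⟧-formula β
  ⟦⟧-formula (α ⇒ β) = ⟦⟧-formula α ⇒ ⟦⟧-formula β
  ⟦⟧-formula (¬ α)   = ⟦⟧-formula α
  ⟦⟧-formula (∼ α)   = ∼ ⟦⟧-formula α

  ⟦⟧-sound : ∀ {α} → JP′⁺ ⊢ α → JP′ ⊢ ⟦ α ⟧
  ⟦⟧-sound (axiom {α} _ (inj₁ s)) = axiom (⟦⟧-formula α) (inj₁ (⟦⟧-A1–A7 s))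
  ⟦⟧-sound (axiom {α} _ (inj₂ s)) = axiom (⟦⟧-formula α) (inj₂ (⟦⟧-A13,P′ s))
  ⟦⟧-sound (mp d e)               = mp (⟦⟧-sound d) (⟦⟧-sound e)

  -- The schemes of JP′ mention neither `⊥` nor `¬`, so replacing `⊥` by `⊤` and deleting `¬` keeps
  -- every axiom an instance of its scheme and leaves JP′-formulas unchanged.
  JP′⁺-conservative : ∀ {α} → α ∈ FormulaJP′ → JP′⁺ ⊢ α → JP′ ⊢ α
  JP′⁺-conservative a d = subst (JP′ ⊢_) (⟦⟧-fixed a (λ _ → refl)) (⟦⟧-sound d)

-- From ILM to JP′

open NaturalDeduction JP′⁺ (λ _ → _) inj₁

-- This is A13 with `⊤` in place of `β`; `∼-elim` is A13 with `⊤` in place of `α`.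
∼-intro : ∀ {Γ α} → α ∷ Γ ⊩ ∼ ⊤ → Γ ⊩ ∼ α
∼-intro d = app (app (scheme (inj₂ (A13 _ ⊤))) (pos (A7 _))) (deduce d)

∼-elim : ∀ {Γ α} → Γ ⊩ ∼ α → Γ ⊩ α → Γ ⊩ ∼ ⊤
∼-elim d e = app (app (scheme (inj₂ (A13 ⊤ _))) (const e)) (const d)

module BottomInterpretation
  (σ : ℕ → Expr) (b : Expr)
  (b⇒∼⊤ : ∀ {Γ} → Γ ⊩ b ⇒ ∼ ⊤) (b⇒σ : ∀ {Γ} n → Γ ⊩ b ⇒ σ n)
  where

  open Interpretation σ b (_⇒ b)

  ex-falso : ∀ {Γ} α → Γ ⊩ b ⇒ ⟦ α ⟧
  ex-falso (var n) = b⇒σ n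
  ex-falso ⊤       = pos (A7 b)
  ex-falso ⊥       = identity
  ex-falso (α ∧ β) = deduce (∧-intro (app (ex-falso α) #0) (app (ex-falso β) #0))
  ex-falso (α ∨ β) = deduce (app (pos (A3ˡ _ _)) (app (ex-falso α) #0))
  ex-falso (α ⇒ β) = deduce (const (app (ex-falso β) #0))
  -- The translation of `¬ α` is `⟦ α ⟧ ⇒ b`.
  ex-falso (¬ α)   = pos (A1 _ _)
  ex-falso (∼ α)   = deduce (∼-intro (app b⇒∼⊤ #1))

  stable-∼⊤ : ∀ {Γ} → Γ ⊩ ((∼ ⊤ ⇒ b) ⇒ b) ⇒ ∼ ⊤
  stable-∼⊤ =
    -- By P′ it suffices to refute `∼ ⊤ ⇒ b` in the sense of `∼`: together with the hypothesis it
    -- gives `b`, hence `∼ ⊤`.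
    deduce (∼-elim (scheme (inj₂ (P′ b))) (∼-intro (app b⇒∼⊤ (app #1 #0))))

  ⟦⟧-A8–A11 : ∀ {α} → α ∈ SchemeA8–A11 → [] ⊩ ⟦ α ⟧
  ⟦⟧-A8–A11 (A8 α)    = ex-falso α
  ⟦⟧-A8–A11 (A9 α β)  = deduce (deduce (deduce (app (app #1 #0) (app #2 #0))))
  ⟦⟧-A8–A11 (A10 α β) = deduce (deduce (app (ex-falso β) (app #1 #0)))
  ⟦⟧-A8–A11 (A11 α)   = ∧-intro
    (deduce (deduce (deduce (app #0 (∼-elim #2 #1)))))
    (deduce (∼-intro (app stable-∼⊤ (app #1 #0))))

  ⟦⟧-sound : ∀ {α} → ILM ⊢ α → JP′⁺ ⊢ ⟦ α ⟧
  ⟦⟧-sound (axiom _ (inj₁ s)) = axiom _ (inj₁ (⟦⟧-A1–A7 s))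
  ⟦⟧-sound (axiom _ (inj₂ s)) = discharge (⟦⟧-A8–A11 s)
  ⟦⟧-sound (mp d e)           = mp (⟦⟧-sound d) (⟦⟧-sound e)

truncate : ℕ → ℕ → Expr
truncate n m with m <? n
... | yes _ = var m
-- `bottom n` has only finitely many variables as conjuncts but must imply every value of the
-- substitution; `⊤` is implied by anything.
... | no  _ = ⊤

truncate-below : ∀ {n m} → m < n → truncate n m ≡ var m
truncate-below {n} {m} m<n with m <? n
... | yes _   = refl
... | no  m≮n = contradiction m<n m≮n

bottom : ℕ → Expr
bottom zero    = ∼ ⊤
bottom (suc n) = var n ∧ bottom n

bottom⇒∼⊤ : ∀ {Γ} n → Γ ⊩ bottom n ⇒ ∼ ⊤
bottom⇒∼⊤ zero    = identity
bottom⇒∼⊤ (suc n) = deduce (app (bottom⇒∼⊤ n) (∧-elimʳ #0))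

bottom⇒var : ∀ {Γ n m} → m < n → Γ ⊩ bottom n ⇒ var m
bottom⇒var {n = suc n} m<1+n with m<1+n⇒m<n∨m≡n m<1+n
... | inj₁ m<n  = deduce (app (bottom⇒var m<n) (∧-elimʳ #0))
... | inj₂ refl = pos (A5ˡ _ _)

bottom⇒truncate : ∀ {Γ} n m → Γ ⊩ bottom n ⇒ truncate n m
bottom⇒truncate n m with m <? n
... | yes m<n = bottom⇒var m<n
... | no  _   = pos (A7 _)

ILM⊆JP′ : ∀ {α} → α ∈ FormulaJP′ → ILM ⊢ α → JP′ ⊢ α
ILM⊆JP′ {α} a d =
  Erasure.JP′⁺-conservative a
    -- Truncating at the width of `α` fixes all its variables, so `α` is its own translation.
    (subst (JP′⁺ ⊢_) (⟦⟧-fixed a truncate-below) (⟦⟧-sound d))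
  where
  n = width α
  open Interpretation (truncate n) (bottom n) (_⇒ bottom n)
  open BottomInterpretation (truncate n) (bottom n)
    (bottom⇒∼⊤ n) (bottom⇒truncate n)

theorem3p9 : ILM IsExtensionOf JP′
theorem3p9 = (λ {α} _ → FormulaILM-total α) , λ a → mk⇔ JP′⊆ILM (ILM⊆JP′ a)
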